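{- Consider the following algorithm, with input a signed graph $G=(V,E)$: Step 1: If $V=\emptyset$, output the empty sequence $()$. Otherwise go to Step 2. Step 2: Find a vertex $v\in S(G)$ and go to Step 3. If no such vertex exists, output NULL. Step 3: Perform this algorithm recursively for input $G\setminus v$. If it outputs a sequence $(w_1,\dots,w_k)$, then output the sequence $(w_1,\dots,w_k,v)$. If it outputs NULL, then output NULL. Then $G$ is signed-eliminable if and only if the algorithm outputs a (possibly empty) sequence, not NULL. Moreover, if the output is a sequence $(v_1,\dots,v_n)$, then the map $\nu:v_i\mapsto i$ is a signed elimination ordering on $G$.
   Context: All graphs are finite, simple and undirected. A signed graph is a graph $G=(V,E)$ together with a partition $E=E_+\sqcup E_-$ (either part may be empty); put $G_\sigma=(V,E_\sigma)$ for $\sigma\in\{+,-\}$, and let $-\sigma$ be the opposite sign. $G\setminus v$ is the induced signed subgraph on $V\setminus\{v\}$. An ordering on $G$ is a bijection $\nu:V\to\{1,\dots,|V|\}$. It is a signed elimination ordering (SEO) if for every triple $(u,v,w)$ of distinct vertices with $\nu(u)<\nu(w)>\nu(v)$ and each $\sigma\in\{+,-\}$: (E1) if $uw,wv\in E_\sigma$ then $uv\in E_\sigma$; (E2) if $uv\in E_\sigma$ and $vw\in E_{ -\sigma}$ then $uw\in E_\sigma$. $G$ is signed-eliminable if it admits a SEO. A vertex $v$ is signed-simplicial in $G$ if for each $\sigma\in\{+,-\}$: (S1) $N_{G_\sigma}[v]=\{v\}\cup\{w: vw\in E_\sigma\}$ is a clique in $G_\sigma$; (S2) whenever $uw\in E_{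 -\sigma}$ and $wv\in E_\sigma$, then $uv\in E_{ -\sigma}$. $S(G)$ denotes the set of signed-simplicial vertices of $G$. The choice of $v\in S(G)$ in Step 2 is arbitrary. -}

module Defs where

open import Data.Fin using (Fin; _<_; punchIn)
open import Data.Maybe using (Maybe; just; nothing)
import Data.Maybe as Maybe
open import Data.Nat using (ℕ; zero; suc)
open import Data.Product using (∃; _×_)
open import Data.Sign using (Sign; opposite)
open import Data.Sum using (_⊎_)
open import Data.Vec using (Vec; []; _∷ʳ_)
import Data.Vec as Vec
open import Function using (_⤖_; Bijection)
open import Level using (0ℓ)
open import Relation.Binary using (Rel; Decidable; Symmetric; Irreflexive)
open import Relation.Binary.PropositionalEquality using (_≡_; _≢_; refl)
open import Relation.Nullary using (¬_)
open import Relation.Unary using (Pred; _∈_)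

-- A signed graph with vertex set Fin n.  E σ u v says that uv is an edge of
-- sign σ, so the underlying edge set is the union of the two (disjoint) parts.
record SignedGraph (n : ℕ) : Set₁ where
  field
    E        : Sign → Rel (Fin n) 0ℓ
    E?       : ∀ σ → Decidable (E σ)
    symm     : ∀ σ → Symmetric (E σ)
    loopless : ∀ σ → Irreflexive _≡_ (E σ)
    disjoint : ∀ σ {u v} → E σ u v → ¬ E (opposite σ) u v

open SignedGraph public using (E)

-- The induced signed subgraph on the vertices other than v, which are
-- relabelled by Fin n: vertex i of G ∖ v is the vertex punchIn v i of G.
_∖_ : ∀ {n} → SignedGraph (suc n) → Fin (suc n) → SignedGraph n
G ∖ v = record
  { E        = λ σ i j → G.E σ (punchIn v i) (punchIn v j)
  ; E?       = λ σ i j → G.E? σ (punchIn v i) (punchIn v j)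
  ; symm     = λ σ → G.symm σ
  ; loopless = λ { σ refl → G.loopless σ refl }
  ; disjoint = λ σ → G.disjoint σ
  }
  where module G = SignedGraph G

-- Positions 1, …, n are represented by Fin n, in the same order.
Ordering : ℕ → Set
Ordering n = Fin n ⤖ Fin n

record IsSEO {n} (G : SignedGraph n) (ν : Ordering n) : Set where
  open Bijection ν using (to)
  field
    E1 : ∀ {u v w} → u ≢ v → v ≢ w → u ≢ w → to u < to w → to v < to w →
         ∀ σ → E G σ u w → E G σ w v → E G σ u v
    E2 : ∀ {u v w} → u ≢ v → v ≢ w → u ≢ w → to u < to w → to v < to w →
         ∀ σ → E G σ u v → E G (opposite σ) v w → E G σ u w

SignedEliminable : ∀ {n} → SignedGraph n → Set
SignedEliminable G = ∃ λ ν → IsSEO G ν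

IsClique : ∀ {n} → Rel (Fin n) 0ℓ → Pred (Fin n) 0ℓ → Set
IsClique R P = ∀ {u w} → u ∈ P → w ∈ P → u ≢ w → R u w

N[_] : ∀ {n} → Rel (Fin n) 0ℓ → Fin n → Pred (Fin n) 0ℓ
N[ R ] v = λ w → w ≡ v ⊎ R v w

record SignedSimplicial {n} (G : SignedGraph n) (v : Fin n) : Set where
  field
    S1 : ∀ σ → IsClique (E G σ) (N[ E G σ ] v)
    S2 : ∀ σ {u w} → E G (opposite σ) u w → E G σ w v → E G (opposite σ) u v

S : ∀ {n} → SignedGraph n → Pred (Fin n) 0ℓ
S G = SignedSimplicial G

-- Each call on a graph with n vertices that outputs a sequence outputs one of
-- length n; nothing stands for NULL.
Output : ℕ → Set
Output n = Maybe (Vec (Fin n) n)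

infix 4 _⇓_

-- G ⇓ r: some run of the algorithm on input G outputs r.  It is a relation
-- because the choice of a signed-simplicial vertex is arbitrary.  In the
-- recursive step punchIn v turns vertices of G ∖ v back into vertices of G.
data _⇓_ : ∀ {n} → SignedGraph n → Output n → Set₁ where
  empty  : {G : SignedGraph zero} → G ⇓ just []
  stuck  : ∀ {n} {G : SignedGraph (suc n)} → (∀ v → ¬ (v ∈ S G)) → G ⇓ nothing
  remove : ∀ {n} {G : SignedGraph (suc n)} {v r} → v ∈ S G → (G ∖ v) ⇓ r →
           G ⇓ Maybe.map (λ ws → Vec.map (punchIn v) ws ∷ʳ v) r

{-# OPTIONS --safe #-}
-- The last vertex of a signed elimination ordering is signed-simplicial, and
-- conversely a signed-simplicial vertex may be appended to any SEO of the graph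
-- without it.  As SEOs restrict to induced subgraphs, removing an arbitrary
-- signed-simplicial vertex preserves eliminability, so no choice made by the
-- algorithm can lead a signed-eliminable graph to NULL.
module Submission where

open import Defs
open import Data.Fin using (Fin; zero; suc; _<_; _≤_; fromℕ; inject₁; punchIn; _≟_)
open import Data.Fin.Permutation
  using (id; insert; insert-punchIn; punchIn-permute)
  renaming (remove to removePoint)
open import Data.Fin.Properties
  using (all?; any?; ≤∧≢⇒<; ≤fromℕ; punchIn-mono-≤; punchIn-cancel-≤;
         punchIn-injective; punchIn-punchOut)
open import Data.Fin.Relation.Unary.Top using (view; ‵fromℕ; ‵inject₁)
open import Data.Maybe using (just)
open import Data.Nat using (ℕ; zero; suc)
import Data.Nat.Properties as ℕ
open import Data.Product using (∃; _×_; _,_; proj₁; proj₂)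
open import Data.Sign using (Sign; opposite; +; -)
open import Data.Sum using (inj₁; inj₂)
open import Data.Vec using (Vec; []; _∷_; _∷ʳ_; lookup)
import Data.Vec as Vec
open import Data.Vec.Properties using (lookup-map)
open import Function using (_⇔_; Bijection; _∘_; mk⇔)
open import Function.Properties.Bijection using (⤖⇒↔)
open import Function.Properties.Inverse using (↔⇒⤖)
open import Relation.Binary.PropositionalEquality
  using (_≡_; _≢_; refl; sym; trans; cong; subst; subst₂; module ≡-Reasoning)
open import Relation.Nullary using (Dec; yes; no; contradiction)
open import Relation.Nullary.Decidable
  using (map′; _×-dec_; _⊎-dec_; _→-dec_; ¬?)
open import Relation.Unary using (_∈_)

private
  variable
    n : ℕ

-- Matching on this view separates `v` from the vertices that survive its removal and puts the
-- latter into the form `punchIn v i`, where edges of `G ∖ v` are edges of `G` by definition.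
data PunchInView (v : Fin (suc n)) : Fin (suc n) → Set where
  pivot : PunchInView v v
  other : ∀ i → PunchInView v (punchIn v i)

punchInView : (v u : Fin (suc n)) → PunchInView v u
punchInView v u with v ≟ u
... | yes refl = pivot
... | no v≢u   = subst (PunchInView v) (punchIn-punchOut v≢u) (other _)

punchIn-mono-< : ∀ (v : Fin (suc n)) {i j} → i < j → punchIn v i < punchIn v j
punchIn-mono-< v i<j = ℕ.≰⇒> (ℕ.<⇒≱ i<j ∘ punchIn-cancel-≤ v _ _)

punchIn-cancel-< : ∀ (v : Fin (suc n)) {i j} → punchIn v i < punchIn v j → i < j
punchIn-cancel-< v i<j = ℕ.≰⇒> (ℕ.<⇒≱ i<j ∘ punchIn-mono-≤ v _ _)

punchIn-fromℕ : (i : Fin n) → punchIn (fromℕ n) i ≡ inject₁ i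
punchIn-fromℕ zero    = refl
punchIn-fromℕ (suc i) = cong suc (punchIn-fromℕ i)

lookup-∷ʳ-fromℕ : ∀ {A : Set} (xs : Vec A n) x → lookup (xs ∷ʳ x) (fromℕ n) ≡ x
lookup-∷ʳ-fromℕ []       x = refl
lookup-∷ʳ-fromℕ (_ ∷ xs) x = lookup-∷ʳ-fromℕ xs x

lookup-∷ʳ-inject₁ : ∀ {A : Set} (xs : Vec A n) x i →
                    lookup (xs ∷ʳ x) (inject₁ i) ≡ lookup xs i
lookup-∷ʳ-inject₁ (_ ∷ _)  x zero    = refl
lookup-∷ʳ-inject₁ (_ ∷ xs) x (suc i) = lookup-∷ʳ-inject₁ xs x i

module _ (v : Fin (suc n)) where

  restrict : Ordering (suc n) → Ordering n
  restrict ν = ↔⇒⤖ (removePoint v (⤖⇒↔ ν))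

  -- By `punchIn-permute`, positions under `ν` are the restricted ones with a gap opened at the
  -- position of `v`, and opening a gap keeps strict order.
  restrict-cancel-< : ∀ (ν : Ordering (suc n)) {i j} →
                      Bijection.to (restrict ν) i < Bijection.to (restrict ν) j →
                      Bijection.to ν (punchIn v i) < Bijection.to ν (punchIn v j)
  restrict-cancel-< ν i<j =
    subst₂ _<_ (sym (punchIn-permute (⤖⇒↔ ν) v _)) (sym (punchIn-permute (⤖⇒↔ ν) v _))
      (punchIn-mono-< (Bijection.to ν v) i<j)

  -- `fromℕ n` is the largest of the `suc n` positions, so `v` comes last and the other positions do
  -- not shift.
  append : Ordering n → Ordering (suc n)
  append ν = ↔⇒⤖ (insert v (fromℕ n) (⤖⇒↔ ν))

  append-pivot : ∀ ν → Bijection.to (append ν) v ≡ fromℕ n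
  append-pivot ν with v ≟ v
  ... | yes _  = refl
  ... | no v≢v = contradiction refl v≢v

  append-punchIn : ∀ ν i → Bijection.to (append ν) (punchIn v i) ≡
                           punchIn (fromℕ n) (Bijection.to ν i)
  append-punchIn ν = insert-punchIn v (fromℕ n) (⤖⇒↔ ν)

  append-cancel-< : ∀ (ν : Ordering n) {i j} →
                    Bijection.to (append ν) (punchIn v i) < Bijection.to (append ν) (punchIn v j) →
                    Bijection.to ν i < Bijection.to ν j
  append-cancel-< ν i<j = punchIn-cancel-< (fromℕ n)
    (subst₂ _<_ (append-punchIn ν _) (append-punchIn ν _) i<j)

  -- No position exceeds that of `v`. The arbitrary `A` lets this close absurd cases of any type.
  append-pivot-≮ : ∀ (ν : Ordering n) {u} {A : Set} →
                   Bijection.to (append ν) v < Bijection.to (append ν) u → A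
  append-pivot-≮ ν {u} v<u =
    contradiction (≤fromℕ w) (ℕ.<⇒≱ (subst (_< w) (append-pivot ν) v<u))
    where w = Bijection.to (append ν) u

  -- The induction step for reading the ordering off the output: the final entry is `v`, in the top
  -- position, and earlier entries keep their places.
  lookup-append : ∀ ν (ws : Vec (Fin n) n) →
                  (∀ i → Bijection.to ν (lookup ws i) ≡ i) →
                  ∀ i → Bijection.to (append ν) (lookup (Vec.map (punchIn v) ws ∷ʳ v) i) ≡ i
  lookup-append ν ws ν-ws i with view i
  ... | ‵fromℕ = trans (cong to (lookup-∷ʳ-fromℕ (Vec.map (punchIn v) ws) v)) (append-pivot ν)
    where open Bijection (append ν) using (to)
  ... | ‵inject₁ j = begin
    to (lookup (Vec.map (punchIn v) ws ∷ʳ v) (inject₁ j))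
      ≡⟨ cong to (lookup-∷ʳ-inject₁ (Vec.map (punchIn v) ws) v j) ⟩
    to (lookup (Vec.map (punchIn v) ws) j)
      ≡⟨ cong to (lookup-map j (punchIn v) ws) ⟩
    to (punchIn v (lookup ws j))
      ≡⟨ append-punchIn ν _ ⟩
    punchIn (fromℕ n) (Bijection.to ν (lookup ws j))
      ≡⟨ cong (punchIn (fromℕ n)) (ν-ws j) ⟩
    punchIn (fromℕ n) j
      ≡⟨ punchIn-fromℕ j ⟩
    inject₁ j ∎
    where
    open Bijection (append ν) using (to)
    open ≡-Reasoning

-- Here `v` may sit anywhere in `ν`: E1 and E2 depend only on the relative order within a triple,
-- which survives the deletion. This makes every choice of the algorithm harmless.
restrict-isSEO : ∀ {G : SignedGraph (suc n)} {ν} v → IsSEO G ν → IsSEO (G ∖ v) (restrict v ν)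
restrict-isSEO {ν = ν} v seo = record
  { E1 = λ u≢v v≢w u≢w u<w v<w →
      IsSEO.E1 seo (inj u≢v) (inj v≢w) (inj u≢w) (restrict-cancel-< v ν u<w) (restrict-cancel-< v ν v<w)
  ; E2 = λ u≢v v≢w u≢w u<w v<w →
      IsSEO.E2 seo (inj u≢v) (inj v≢w) (inj u≢w) (restrict-cancel-< v ν u<w) (restrict-cancel-< v ν v<w)
  }
  where
  inj : ∀ {i j} → i ≢ j → punchIn v i ≢ punchIn v j
  inj i≢j = i≢j ∘ punchIn-injective v _ _

-- This is S2 at sign `opposite σ`. The sign is split because `opposite (opposite σ)` reduces only
-- for a concrete sign.
simplicial-S2 : ∀ {G : SignedGraph n} {v} → v ∈ S G → ∀ σ {u w} →
                E G σ u w → E G (opposite σ) w v → E G σ u v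
simplicial-S2 v∈S + = SignedSimplicial.S2 v∈S -
simplicial-S2 v∈S - = SignedSimplicial.S2 v∈S +

-- Being last, the appended vertex can enter a triple only as `w`, where S1 yields E1 and S2 yields
-- E2. All other triples lie in the smaller graph.
append-isSEO : ∀ {G : SignedGraph (suc n)} {v ν} → v ∈ S G →
               IsSEO (G ∖ v) ν → IsSEO G (append v ν)
append-isSEO {G = G} {v₀} {ν} v₀∈S seo = record { E1 = E1 ; E2 = E2 }
  where
  open Bijection (append v₀ ν) using (to)
  symm = SignedGraph.symm G

  E1 : ∀ {u v w} → u ≢ v → v ≢ w → u ≢ w → to u < to w → to v < to w →
       ∀ σ → E G σ u w → E G σ w v → E G σ u v
  E1 {u} {v} {w} u≢v v≢w u≢w u<w v<w σ uw wv
    with punchInView v₀ w | punchInView v₀ u | punchInView v₀ v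
  ... | pivot   | _       | _       =
    SignedSimplicial.S1 v₀∈S σ (inj₂ (symm σ uw)) (inj₂ wv) u≢v
  ... | other _ | pivot   | _       = append-pivot-≮ v₀ ν u<w
  ... | other _ | other _ | pivot   = append-pivot-≮ v₀ ν v<w
  ... | other _ | other _ | other _ =
    IsSEO.E1 seo (u≢v ∘ cong _) (v≢w ∘ cong _) (u≢w ∘ cong _)
      (append-cancel-< v₀ ν u<w) (append-cancel-< v₀ ν v<w) σ uw wv

  E2 : ∀ {u v w} → u ≢ v → v ≢ w → u ≢ w → to u < to w → to v < to w →
       ∀ σ → E G σ u v → E G (opposite σ) v w → E G σ u w
  E2 {u} {v} {w} u≢v v≢w u≢w u<w v<w σ uv vw
    with punchInView v₀ w | punchInView v₀ u | punchInView v₀ v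
  ... | pivot   | _       | _       = simplicial-S2 v₀∈S σ uv vw
  ... | other _ | pivot   | _       = append-pivot-≮ v₀ ν u<w
  ... | other _ | other _ | pivot   = append-pivot-≮ v₀ ν v<w
  ... | other _ | other _ | other _ =
    IsSEO.E2 seo (u≢v ∘ cong _) (v≢w ∘ cong _) (u≢w ∘ cong _)
      (append-cancel-< v₀ ν u<w) (append-cancel-< v₀ ν v<w) σ uv vw

-- Take the vertex in the last position. All others precede it, so E1 and E2 with it as `w` give S1
-- and S2.
eliminable⇒simplicial : ∀ {G : SignedGraph (suc n)} → SignedEliminable G → ∃ λ v → v ∈ S G
eliminable⇒simplicial {n} {G} (ν , seo) = v , record { S1 = S1 ; S2 = S2 }
  where
  open Bijection ν using (to; injective; strictlySurjective)
  open SignedGraph G using (symm; loopless; disjoint)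

  v = proj₁ (strictlySurjective (fromℕ n))

  last : ∀ {u} → u ≢ v → to u < to v
  last {u} u≢v = ≤∧≢⇒<
    (subst (to u ≤_) (sym (proj₂ (strictlySurjective (fromℕ n)))) (≤fromℕ (to u)))
    (u≢v ∘ injective)

  adjacent : ∀ σ {u} → E G σ v u → u ≢ v
  adjacent σ vu u≡v = loopless σ (sym u≡v) vu

  S1 : ∀ σ → IsClique (E G σ) (N[ E G σ ] v)
  S1 σ (inj₁ refl) (inj₁ refl) u≢w = contradiction refl u≢w
  S1 σ (inj₁ refl) (inj₂ vw)   u≢w = vw
  S1 σ (inj₂ vu)   (inj₁ refl) u≢w = symm σ vu
  S1 σ (inj₂ vu)   (inj₂ vw)   u≢w =
    IsSEO.E1 seo u≢w (adjacent σ vw) (adjacent σ vu)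
      (last (adjacent σ vu)) (last (adjacent σ vw)) σ (symm σ vu) vw

  -- As in `simplicial-S2`, the sign is split so that the double opposite computes.
  opposite-E2 : ∀ σ {u w} → u ≢ w → w ≢ v → u ≢ v →
                E G (opposite σ) u w → E G σ w v → E G (opposite σ) u v
  opposite-E2 + u≢w w≢v u≢v = IsSEO.E2 seo u≢w w≢v u≢v (last u≢v) (last w≢v) -
  opposite-E2 - u≢w w≢v u≢v = IsSEO.E2 seo u≢w w≢v u≢v (last u≢v) (last w≢v) +

  S2 : ∀ σ {u w} → E G (opposite σ) u w → E G σ w v → E G (opposite σ) u v
  -- E2 needs distinct vertices. Two of the inequalities hold since there are no loops; `u ≡ v`
  -- would make one edge carry both signs.
  S2 σ uw wv = opposite-E2 σ
    (λ u≡w → loopless (opposite σ) u≡w uw)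
    (adjacent σ (symm σ wv))
    (λ { refl → disjoint σ (symm σ wv) uw })
    uw wv

allSigns? : {P : Sign → Set} → (∀ σ → Dec (P σ)) → Dec (∀ σ → P σ)
allSigns? P? = map′ (λ { (p₊ , p₋) + → p₊ ; (p₊ , p₋) - → p₋ }) (λ p → p + , p -)
                    (P? + ×-dec P? -)

-- Signs and vertices are finite in number and edges are decidable. This lets `run` choose
-- constructively between `remove` and `stuck`.
simplicial? : ∀ (G : SignedGraph n) v → Dec (v ∈ S G)
simplicial? {n} G v = map′
  (λ (s₁ , s₂) → record { S1 = λ σ → s₁ σ _ _ ; S2 = λ σ → s₂ σ _ _ })
  (λ v∈S → (λ σ _ _ → SignedSimplicial.S1 v∈S σ) , (λ σ _ _ → SignedSimplicial.S2 v∈S σ))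
  (allSigns? (λ σ → all? λ u → all? λ w →
      N? σ u →-dec N? σ w →-dec ¬? (u ≟ w) →-dec E? σ u w)
   ×-dec
   allSigns? (λ σ → all? λ u → all? λ w →
      E? (opposite σ) u w →-dec E? σ w v →-dec E? (opposite σ) u v))
  where
  open SignedGraph G using (E?)

  N? : ∀ σ u → Dec (u ∈ N[ E G σ ] v)
  N? σ u = (u ≟ v) ⊎-dec E? σ v u

-- Ensures that statements about every output of `G` are not vacuous.
run : ∀ (G : SignedGraph n) → ∃ λ r → G ⇓ r
run {zero}  G = _ , empty
run {suc n} G with any? (simplicial? G)
... | yes (v , v∈S) = _ , remove v∈S (proj₂ (run (G ∖ v)))
... | no ∄v         = _ , stuck (λ v v∈S → ∄v (v , v∈S))

-- Induction on the run: eliminability rules out `stuck` and passes to `G ∖ v` for whichever `v` was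
-- removed.
eliminable⇒just : ∀ {G : SignedGraph n} {r} → G ⇓ r → SignedEliminable G → ∃ λ vs → r ≡ just vs
eliminable⇒just empty       _  = _ , refl
eliminable⇒just (stuck ∄v)  el with v , v∈S ← eliminable⇒simplicial el = contradiction v∈S (∄v v)
eliminable⇒just (remove {v = v} _ G∖v⇓r) (ν , seo)
  with _ , refl ← eliminable⇒just G∖v⇓r (restrict v ν , restrict-isSEO v seo) = _ , refl

-- The result is tied to `vs` by an equation because the index of `remove` is a `Maybe.map`, which
-- computes only once the recursive result is known to be `just ws`.
just⇒isSEO : ∀ {G : SignedGraph n} {r vs} → G ⇓ r → r ≡ just vs →
             ∃ λ ν → (∀ i → Bijection.to ν (lookup vs i) ≡ i) × IsSEO G ν
just⇒isSEO empty refl = ↔⇒⤖ id , (λ ()) , record { E1 = λ { {()} } ; E2 = λ { {()} } }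
just⇒isSEO (remove {v = v} {r = just ws} v∈S G∖v⇓r) refl
  with ν , ν-ws , seo ← just⇒isSEO G∖v⇓r refl =
  append v ν , lookup-append v ν ws ν-ws , append-isSEO v∈S seo

theorem3p13 : ∀ (n : ℕ) (G : SignedGraph n) →
    (∃ λ (r : Output n) → G ⇓ r) ×
    (∀ (r : Output n) → G ⇓ r →
    (SignedEliminable G ⇔ (∃ λ (vs : Vec (Fin n) n) → r ≡ just vs)) ×
    (∀ (vs : Vec (Fin n) n) → r ≡ just vs →
    ∃ λ (ν : Ordering n) →
    (∀ i → Bijection.to ν (lookup vs i) ≡ i) × IsSEO G ν))
theorem3p13 n G = run G , λ r G⇓r →
  mk⇔ (eliminable⇒just G⇓r)
      (λ (vs , r≡just) → let ν , _ , seo = just⇒isSEO G⇓r r≡just in ν , seo) ,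
  λ vs r≡just → just⇒isSEO G⇓r r≡just
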